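{- Let $t_1, t_2 \geq 3$ be integers and let $m, n$ be fixed arbitrary relatively prime positive integers. Then the system of simultaneous Diophantine equations $$m\,(x_1^k + x_2^k + \cdots + x_{t_1}^k) = n\,(y_1^k + y_2^k + \cdots + y_{t_2}^k), \qquad k = 1, 3$$ (both equations, for $k=1$ and for $k=3$, being required to hold simultaneously), has infinitely many nontrivial parametric solutions in non-zero integers $x_1, \dots, x_{t_1}, y_1, \dots, y_{t_2}$.
   Context: For fixed $m,n,t_1,t_2$, a parametric solution of the system is a tuple $(x_1,\dots,x_{t_1},y_1,\dots,y_{t_2})$ of polynomials with integer coefficients in one or more parameters, not all constant, which satisfies both equations ($k=1$ and $k=3$) identically in the parameters; substituting integer values for the parameters then gives integer solutions. It is a parametric solution in non-zero integers if no $x_i$ and no $y_j$ is the zero polynomial, so that integer parameter values at which no entry vanishes give solutions in non-zero integers. A parametric solution is nontrivial if, as polynomials, $x_i \neq \pm x_j$ for all $1\le i\neq j\le t_1$, $y_i \neq \pm y_j$ for all $1\le i\neq j\le t_2$, and $x_i \neq \pm y_j$ for all $1\le i\le t_1$, $1\le j\le t_2$. -}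

module Defs where

open import Level using (0ℓ)
open import Algebra.Bundles.Raw using (RawRing)
import Algebra.Definitions.RawSemiring as RawSemiringDefs
open import Data.Bool using (Bool; true; _∧_; if_then_else_)
open import Data.Integer as ℤ using (ℤ; +_)
open import Data.List using (List; []; _∷_; _++_; map; cartesianProductWith)
open import Data.Nat as ℕ using (ℕ; _≡ᵇ_)
open import Data.Product using (_×_; _,_; ∃-syntax)
open import Data.Vec.Functional using (Vector)
open import Function.Definitions using (Injective)
open import Relation.Binary.PropositionalEquality using (_≡_; _≢_)
open import Relation.Nullary using (¬_)

-- A polynomial with integer coefficients in finitely many parameters is an
-- element of ℤ[u₀,u₁,u₂,…].  Using this one ring lets different solutions
-- have different numbers of parameters and still be compared.

-- e₀ ∷ e₁ ∷ … ∷ [] stands for u₀^e₀ u₁^e₁ ⋯ ; missing exponents are 0, so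
-- lists that differ by trailing zeros are the same monomial.
Monomial : Set
Monomial = List ℕ

sameMonomial : Monomial → Monomial → Bool
sameMonomial []      []      = true
sameMonomial []      (b ∷ f) = (0 ≡ᵇ b) ∧ sameMonomial [] f
sameMonomial (a ∷ e) []      = (a ≡ᵇ 0) ∧ sameMonomial e []
sameMonomial (a ∷ e) (b ∷ f) = (a ≡ᵇ b) ∧ sameMonomial e f

mulMonomial : Monomial → Monomial → Monomial
mulMonomial []      f       = f
mulMonomial (a ∷ e) []      = a ∷ e
mulMonomial (a ∷ e) (b ∷ f) = (a ℕ.+ b) ∷ mulMonomial e f

Term : Set
Term = ℤ × Monomial

mulTerm : Term → Term → Term
mulTerm (c , e) (d , f) = c ℤ.* d , mulMonomial e f

-- A formal sum of terms.  Monomials may repeat and coefficients may be 0: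
-- equality of polynomials is _≈ᵖ_ below, not equality of lists.
Poly : Set
Poly = List Term

coeff : Poly → Monomial → ℤ
coeff []            e = + 0
coeff ((c , f) ∷ p) e = (if sameMonomial f e then c else + 0) ℤ.+ coeff p e

_≈ᵖ_ : Poly → Poly → Set
p ≈ᵖ q = ∀ e → coeff p e ≡ coeff q e

constant : ℤ → Poly
constant c = (c , []) ∷ []

polyRawRing : RawRing 0ℓ 0ℓ
polyRawRing = record
  { Carrier = Poly
  ; _≈_     = _≈ᵖ_
  ; _+_     = _++_
  ; _*_     = cartesianProductWith mulTerm
  ; -_      = map λ (c , e) → ℤ.- c , e
  ; 0#      = []
  ; 1#      = constant (+ 1)
  }

open RawRing polyRawRing using (_≈_; _≉_; _*_; -_; 0#; rawSemiring)
open RawSemiringDefs rawSemiring using (_^_; sum)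

_≉±_ : Poly → Poly → Set
p ≉± q = (p ≉ q) × (p ≉ - q)

IsConstant : Poly → Set
IsConstant p = ∃[ c ] p ≈ constant c

PowerSumEquation : (m n : ℕ) {t₁ t₂ : ℕ} →
                   Vector Poly t₁ → Vector Poly t₂ → ℕ → Set
PowerSumEquation m n x y k =
  constant (+ m) * sum (λ i → x i ^ k) ≈ constant (+ n) * sum (λ j → y j ^ k)

record ParametricSolution (m n t₁ t₂ : ℕ) : Set where
  field
    x              : Vector Poly t₁
    y              : Vector Poly t₂
    notAllConstant : ¬ ((∀ i → IsConstant (x i)) × (∀ j → IsConstant (y j)))
    equation₁      : PowerSumEquation m n x y 1
    equation₃      : PowerSumEquation m n x y 3

module _ {m n t₁ t₂ : ℕ} where

  open ParametricSolution

  InNonZeroIntegers : ParametricSolution m n t₁ t₂ → Set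
  InNonZeroIntegers s = (∀ i → x s i ≉ 0#) × (∀ j → y s j ≉ 0#)

  Nontrivial : ParametricSolution m n t₁ t₂ → Set
  Nontrivial s =
      (∀ i j → i ≢ j → x s i ≉± x s j)
    × (∀ i j → i ≢ j → y s i ≉± y s j)
    × (∀ i j → x s i ≉± y s j)

  _≋_ : ParametricSolution m n t₁ t₂ → ParametricSolution m n t₁ t₂ → Set
  s ≋ s′ = (∀ i → x s i ≈ x s′ i) × (∀ j → y s j ≈ y s′ j)

  InfinitelyMany : (ParametricSolution m n t₁ t₂ → Set) → Set
  InfinitelyMany P =
    ∃[ s ] (∀ (k : ℕ) → P (s k)) × Injective _≡_ _≋_ s

{-# OPTIONS --safe #-}

-- The system is homogeneous, so an integer solution with non-zero entries of
-- pairwise distinct absolute values yields the parametric solutions obtained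
-- by multiplying it with u₀^(k+1).  It remains to find one such integer
-- solution for all t₁, t₂ ≥ 3 and m, n ≥ 1.
--
-- If t₁ ≥ 4 (or, symmetrically, t₂ ≥ 4), take fixed vectors α, β of length 4,
-- 5 or 6 for which αt + β has sum 0 and sum of cubes G (t + c).  Being linear
-- in t, this sum of cubes can be matched to that of any zero-sum vectors z and
-- y, scaled suitably; z pads the left-hand side and y is the right-hand side.
-- Since t grows like the cube of the scaling factor, the entries of αt + β
-- exceed all the others.  The case t₁ = t₂ = 3 has an explicit solution with
-- both sums equal to 0.
module Submission where

open import Defs
open import Algebra.Bundles.Raw using (RawRing)
import Algebra.Definitions.RawSemiring as RawSemiringDefs
open import Data.Bool using (true; false; T; if_then_else_)
open import Data.Empty using (⊥-elim)
open import Data.Fin using (Fin; zero; suc; fromℕ<)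
open import Data.Integer.Base as ℤ using (ℤ; +_; ∣_∣; 0ℤ; 1ℤ; _◃_)
import Data.Integer.Properties as ℤₚ
open import Data.Integer.Tactic.RingSolver using (solve-∀)
open import Data.List using (List; []; _∷_; _++_; map; length; lookup)
open import Data.List.Properties using (length-++; length-map)
open import Data.List.Relation.Unary.All as All using (All; []; _∷_)
import Data.List.Relation.Unary.All.Properties as All
open import Data.List.Membership.Propositional.Properties using (∈-lookup)
open import Data.List.Relation.Unary.AllPairs as AllPairs using (AllPairs; []; _∷_)
import Data.List.Relation.Unary.AllPairs.Properties as AllPairs
open import Data.List.Relation.Unary.Linked using ([-]; _∷_)
open import Data.List.Relation.Unary.Linked.Properties using (Linked⇒AllPairs)
open import Data.Nat as ℕ using (ℕ; zero; suc; _≤_; _<_; NonZero; s≤s; z≤n; _≡ᵇ_)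
open import Data.Nat.Coprimality using (Coprime)
import Data.Nat.Properties as ℕ
import Data.Nat.Tactic.RingSolver as ℕ-Solver
open import Data.Product using (_×_; _,_; proj₁; proj₂; ∃-syntax)
open import Data.Sign as Sign using (Sign)
import Data.Sign.Properties as Sign
open import Function using (_∘_; _on_)
open import Relation.Binary.Definitions using (Symmetric)
open import Relation.Binary.PropositionalEquality
  using (_≡_; _≢_; refl; sym; trans; cong; cong₂; subst; subst₂; ≢-sym; module ≡-Reasoning)
open import Relation.Nullary using (¬_; Dec)
open import Relation.Nullary.Decidable using (_×-dec_; toWitness)

private
  variable
    A : Set

-- Sums and power sums

sumOf : (A → ℤ) → List A → ℤ
sumOf f []       = 0ℤ
sumOf f (x ∷ xs) = f x ℤ.+ sumOf f xs

powerSum : ℕ → List ℤ → ℤ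
powerSum k = sumOf (ℤ._^ k)

sumOf-++ : ∀ (f : A → ℤ) xs ys → sumOf f (xs ++ ys) ≡ sumOf f xs ℤ.+ sumOf f ys
sumOf-++ f []       ys = sym (ℤₚ.+-identityˡ _)
sumOf-++ f (x ∷ xs) ys =
  trans (cong (ℤ._+_ (f x)) (sumOf-++ f xs ys)) (sym (ℤₚ.+-assoc (f x) _ _))

powerSum-scale₁ : ∀ c xs → powerSum 1 (map (c ℤ.*_) xs) ≡ c ℤ.* powerSum 1 xs
powerSum-scale₁ c []       = sym (ℤₚ.*-zeroʳ c)
powerSum-scale₁ c (x ∷ xs) =
  trans (cong (ℤ._+_ ((c ℤ.* x) ℤ.^ 1)) (powerSum-scale₁ c xs)) (step c x _)
  where
  step : ∀ c x s → c ℤ.* x ℤ.* 1ℤ ℤ.+ c ℤ.* s ≡ c ℤ.* (x ℤ.* 1ℤ ℤ.+ s)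
  step = solve-∀

cube : ℤ → ℤ
cube c = c ℤ.* c ℤ.* c

powerSum-scale₃ : ∀ c xs → powerSum 3 (map (c ℤ.*_) xs) ≡ cube c ℤ.* powerSum 3 xs
powerSum-scale₃ c []       = sym (ℤₚ.*-zeroʳ (cube c))
powerSum-scale₃ c (x ∷ xs) =
  trans (cong (ℤ._+_ ((c ℤ.* x) ℤ.^ 3)) (powerSum-scale₃ c xs)) (step c x _)
  where
  step : ∀ c x s → c ℤ.* x ℤ.* (c ℤ.* x ℤ.* (c ℤ.* x ℤ.* 1ℤ)) ℤ.+ c ℤ.* c ℤ.* c ℤ.* s
                 ≡ c ℤ.* c ℤ.* c ℤ.* (x ℤ.* (x ℤ.* (x ℤ.* 1ℤ)) ℤ.+ s)
  step = solve-∀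

-- Integer solutions

infix 4 _#_

-- Comparing absolute values excludes equality up to sign at once, which matches the two halves of
-- `_≉±_`.
_#_ : ℤ → ℤ → Set
a # b = ∣ a ∣ ≢ ∣ b ∣

0<∣∣⇒≢0 : ∀ {x} → 0 < ∣ x ∣ → x ≢ 0ℤ
0<∣∣⇒≢0 () refl

record IntegerSolution (m n t₁ t₂ : ℕ) : Set where
  field
    xs ys      : List ℤ
    length-xs  : length xs ≡ t₁
    length-ys  : length ys ≡ t₂
    equation₁  : + m ℤ.* powerSum 1 xs ≡ + n ℤ.* powerSum 1 ys
    equation₃  : + m ℤ.* powerSum 3 xs ≡ + n ℤ.* powerSum 3 ys
    positive-xs : All (λ x → 0 < ∣ x ∣) xs
    positive-ys : All (λ x → 0 < ∣ x ∣) ys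
    distinct-xs : AllPairs _#_ xs
    distinct-ys : AllPairs _#_ ys
    distinct    : All (λ x → All (x #_) ys) xs

swap : ∀ {m n t₁ t₂} → IntegerSolution m n t₁ t₂ → IntegerSolution n m t₂ t₁
swap s = record
  { xs = ys ; ys = xs ; length-xs = length-ys ; length-ys = length-xs
  ; equation₁ = sym equation₁ ; equation₃ = sym equation₃
  ; positive-xs = positive-ys ; positive-ys = positive-xs
  ; distinct-xs = distinct-ys ; distinct-ys = distinct-xs
  ; distinct = All.map (All.map ≢-sym) (All.All-swap distinct)
  } where open IntegerSolution s

-- From an integer solution to parametric solutions

module Lift where

  open RawRing polyRawRing using (_≈_; _≉_; _*_; -_; 0#; rawSemiring)
  open RawSemiringDefs rawSemiring using (_^_; sum)

  monomial : ℤ → ℕ → Poly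
  monomial c k = (c , k ∷ []) ∷ []

  ≡ᵇ-refl : ∀ k → (k ≡ᵇ k) ≡ true
  ≡ᵇ-refl zero    = refl
  ≡ᵇ-refl (suc k) = ≡ᵇ-refl k

  coeff-monomial : ∀ c k → coeff (monomial c k) (k ∷ []) ≡ c
  coeff-monomial c k rewrite ≡ᵇ-refl k = ℤₚ.+-identityʳ c

  monomial-injective : ∀ {c d} k → monomial c k ≈ monomial d k → c ≡ d
  monomial-injective {c} {d} k p =
    trans (sym (coeff-monomial c k)) (trans (p (k ∷ [])) (coeff-monomial d k))

  monomial≉0 : ∀ {c} k → c ≢ 0ℤ → monomial c k ≉ 0#
  monomial≉0 {c} k c≢0 p = c≢0 (trans (sym (coeff-monomial c k)) (p (k ∷ [])))

  -- A constant has coefficient 0 at u₀^(k+1), by computation, because the exponent is a successor.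
  monomial-nonConstant : ∀ {c} k → c ≢ 0ℤ → ¬ IsConstant (monomial c (suc k))
  monomial-nonConstant {c} k c≢0 (_ , p) =
    c≢0 (trans (sym (coeff-monomial c (suc k))) (p (suc k ∷ [])))

  -- Compare the coefficients at u₀^k: on the left it is c, on the right it is 0 unless l = k.
  exponent-injective : ∀ {c} k l → c ≢ 0ℤ → monomial c k ≈ monomial c l → k ≡ l
  exponent-injective {c} k l c≢0 p with l ≡ᵇ k in eq | p (k ∷ [])
  ... | true  | _ = sym (ℕ.≡ᵇ⇒≡ l k (subst T (sym eq) _))
  ... | false | q = ⊥-elim (c≢0 (trans (sym (coeff-monomial c k)) q))

  coeff-constant* : ∀ c p e → coeff (constant c * p) e ≡ c ℤ.* coeff p e
  coeff-constant* c []            e = sym (ℤₚ.*-zeroʳ c)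
  coeff-constant* c ((d , f) ∷ p) e with sameMonomial f e
  ... | true  = trans (cong (ℤ._+_ (c ℤ.* d)) (coeff-constant* c p e)) (sym (ℤₚ.*-distribˡ-+ c d _))
  ... | false = trans (ℤₚ.+-identityˡ _) (trans (coeff-constant* c p e)
                  (cong (c ℤ.*_) (sym (ℤₚ.+-identityˡ _))))

  coeff-sum : ∀ k f e xs → coeff (sum (λ i → (lookup xs i ℤ.^ k , f) ∷ [])) e
                         ≡ (if sameMonomial f e then powerSum k xs else 0ℤ)
  coeff-sum k f e [] with sameMonomial f e
  ... | true  = refl
  ... | false = refl
  coeff-sum k f e (x ∷ xs) with sameMonomial f e | coeff-sum k f e xs
  ... | true  | ih = cong (ℤ._+_ (x ℤ.^ k)) ih
  ... | false | ih = trans (ℤₚ.+-identityˡ _) ih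

  -- All summands on both sides carry the same monomial f, so only the coefficient at f has to be
  -- compared, and there the claim is the integer equation.
  homogeneous : ∀ m n k f xs ys → + m ℤ.* powerSum k xs ≡ + n ℤ.* powerSum k ys →
                constant (+ m) * sum (λ i → (lookup xs i ℤ.^ k , f) ∷ []) ≈
                constant (+ n) * sum (λ j → (lookup ys j ℤ.^ k , f) ∷ [])
  homogeneous m n k f xs ys eq e = begin
    coeff (constant (+ m) * sum X) e  ≡⟨ coeff-constant* (+ m) (sum X) e ⟩
    + m ℤ.* coeff (sum X) e           ≡⟨ cong (+ m ℤ.*_) (coeff-sum k f e xs) ⟩
    + m ℤ.* (if b then powerSum k xs else 0ℤ) ≡⟨ compare b ⟩
    + n ℤ.* (if b then powerSum k ys else 0ℤ) ≡⟨ cong (+ n ℤ.*_) (coeff-sum k f e ys) ⟨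
    + n ℤ.* coeff (sum Y) e           ≡⟨ coeff-constant* (+ n) (sum Y) e ⟨
    coeff (constant (+ n) * sum Y) e  ∎
    where
    open ≡-Reasoning
    b = sameMonomial f e
    X : Fin (length xs) → Poly
    X i = (lookup xs i ℤ.^ k , f) ∷ []
    Y : Fin (length ys) → Poly
    Y j = (lookup ys j ℤ.^ k , f) ∷ []
    compare : ∀ b → + m ℤ.* (if b then powerSum k xs else 0ℤ)
                  ≡ + n ℤ.* (if b then powerSum k ys else 0ℤ)
    compare true  = eq
    compare false = trans (ℤₚ.*-zeroʳ (+ m)) (sym (ℤₚ.*-zeroʳ (+ n)))

  monomial-≉± : ∀ {c d} k → c # d → monomial c k ≉± monomial d k
  monomial-≉± {c} {d} k c#d =
      (λ p → c#d (cong ∣_∣ (monomial-injective k p)))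
    , (λ p → c#d (trans (cong ∣_∣ (monomial-injective k p)) (ℤₚ.∣-i∣≡∣i∣ d)))

  -- `AllPairs` relates earlier entries to later ones only; symmetry supplies the other order.
  lookup-distinct : ∀ {R : A → A → Set} → Symmetric R → ∀ {xs} → AllPairs R xs →
                    ∀ i j → i ≢ j → R (lookup xs i) (lookup xs j)
  lookup-distinct R-sym (r ∷ rs) zero    zero    i≢j = ⊥-elim (i≢j refl)
  lookup-distinct R-sym (r ∷ rs) zero    (suc j) i≢j = All.lookup r (∈-lookup j)
  lookup-distinct R-sym (r ∷ rs) (suc i) zero    i≢j = R-sym (All.lookup r (∈-lookup i))
  lookup-distinct R-sym (r ∷ rs) (suc i) (suc j) i≢j =
    lookup-distinct R-sym rs i j (i≢j ∘ cong suc)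

  infinitelyMany : ∀ {m n t₁ t₂} → 0 < t₁ → IntegerSolution m n t₁ t₂ →
                   InfinitelyMany {m} {n} {t₁} {t₂} (λ s → InNonZeroIntegers s × Nontrivial s)
  infinitelyMany {m} {n} 0<t₁ record
    { xs = xs ; ys = ys ; length-xs = refl ; length-ys = refl
    ; equation₁ = eq₁ ; equation₃ = eq₃ ; positive-xs = 0<∣xs∣ ; positive-ys = 0<∣ys∣
    ; distinct-xs = xs! ; distinct-ys = ys! ; distinct = xs#ys } =
    solution , (λ k → (nonZero k , nontrivial k)) , λ {k} {l} → injective k l
    where
    -- One non-zero entry suffices to show that a solution is not constant and to recover k from the
    -- exponent.
    i₀ : Fin (length xs)
    i₀ = fromℕ< 0<t₁

    nz : ∀ i → lookup xs i ≢ 0ℤ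
    nz i = 0<∣∣⇒≢0 (All.lookup 0<∣xs∣ (∈-lookup i))

    solution : ℕ → ParametricSolution m n (length xs) (length ys)
    solution k = record
      -- The exponent starts at 1, since u₀^0 would give constants.
      { x = λ i → monomial (lookup xs i) (suc k)
      ; y = λ j → monomial (lookup ys j) (suc k)
      ; notAllConstant = λ (c , _) → monomial-nonConstant k (nz i₀) (c i₀)
      -- A power of a one-term polynomial computes to a single term whose coefficient is the power
      -- in ℤ; unification finds its monomial.
      ; equation₁ = homogeneous m n 1 _ xs ys eq₁
      ; equation₃ = homogeneous m n 3 _ xs ys eq₃
      }

    nonZero : ∀ k → InNonZeroIntegers (solution k)
    nonZero k = (λ i → monomial≉0 (suc k) (nz i))
              , (λ j → monomial≉0 (suc k) (0<∣∣⇒≢0 (All.lookup 0<∣ys∣ (∈-lookup j))))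

    nontrivial : ∀ k → Nontrivial (solution k)
    nontrivial k =
        (λ i j i≢j → monomial-≉± (suc k) (lookup-distinct ≢-sym xs! i j i≢j))
      , (λ i j i≢j → monomial-≉± (suc k) (lookup-distinct ≢-sym ys! i j i≢j))
      , (λ i j → monomial-≉± (suc k) (All.lookup (All.lookup xs#ys (∈-lookup i)) (∈-lookup j)))

    injective : ∀ k l → solution k ≋ solution l → k ≡ l
    injective k l (p , _) = ℕ.suc-injective (exponent-injective (suc k) (suc l) (nz i₀) (p i₀))

-- Three terms on both sides

triple : ℤ → ℤ → List ℤ
triple x y = x ∷ y ∷ ℤ.- (x ℤ.+ y) ∷ []

sum-triple : ∀ x y → powerSum 1 (triple x y) ≡ 0ℤ
sum-triple = identity
  where
  identity : ∀ x y → x ℤ.* 1ℤ ℤ.+ (y ℤ.* 1ℤ ℤ.+ (ℤ.- (x ℤ.+ y) ℤ.* 1ℤ ℤ.+ 0ℤ)) ≡ 0ℤ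
  identity = solve-∀

-- This is a³ + b³ + c³ = 3abc for a + b + c = 0. It turns the equation for the cubes into an
-- equation between products.
cubes-triple : ∀ x y → powerSum 3 (triple x y) ≡ ℤ.- (+ 3) ℤ.* (x ℤ.* y ℤ.* (x ℤ.+ y))
cubes-triple = identity
  where
  identity : ∀ x y → x ℤ.* (x ℤ.* (x ℤ.* 1ℤ)) ℤ.+ (y ℤ.* (y ℤ.* (y ℤ.* 1ℤ)) ℤ.+
               (ℤ.- (x ℤ.+ y) ℤ.* (ℤ.- (x ℤ.+ y) ℤ.* (ℤ.- (x ℤ.+ y) ℤ.* 1ℤ)) ℤ.+ 0ℤ))
             ≡ ℤ.- (+ 3) ℤ.* (x ℤ.* y ℤ.* (x ℤ.+ y))
  identity = solve-∀

vanishing-sums : ∀ m n {xs ys} → powerSum 1 xs ≡ 0ℤ → powerSum 1 ys ≡ 0ℤ →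
                 + m ℤ.* powerSum 1 xs ≡ + n ℤ.* powerSum 1 ys
vanishing-sums m n {xs} {ys} p q = begin
  + m ℤ.* powerSum 1 xs ≡⟨ cong (+ m ℤ.*_) p ⟩
  + m ℤ.* 0ℤ            ≡⟨ ℤₚ.*-zeroʳ (+ m) ⟩
  0ℤ                    ≡⟨ ℤₚ.*-zeroʳ (+ n) ⟨
  + n ℤ.* 0ℤ            ≡⟨ cong (+ n ℤ.*_) q ⟨
  + n ℤ.* powerSum 1 ys ∎
  where open ≡-Reasoning

abs-neg : ∀ k → ∣ ℤ.- (+ k) ∣ ≡ k
abs-neg k = ℤₚ.∣-i∣≡∣i∣ (+ k)

-- All six absolute values lie on one increasing chain, from which the two triples are picked in the
-- order in which `triple` lists them.
interleaved-distinct : ∀ {m r a c v w} →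
                       AllPairs (_<_ on ∣_∣) (m ∷ r ∷ a ∷ c ∷ v ∷ w ∷ []) →
                       AllPairs _#_ (a ∷ r ∷ c ∷ []) ×
                       AllPairs _#_ (m ∷ v ∷ w ∷ []) ×
                       All (λ x → All (x #_) (m ∷ v ∷ w ∷ [])) (a ∷ r ∷ c ∷ [])
interleaved-distinct
  ((m<r ∷ m<a ∷ m<c ∷ m<v ∷ m<w ∷ []) ∷ (r<a ∷ r<c ∷ r<v ∷ r<w ∷ []) ∷
   (a<c ∷ a<v ∷ a<w ∷ []) ∷ (c<v ∷ c<w ∷ []) ∷ (v<w ∷ []) ∷ [] ∷ []) =
    (ℕ.>⇒≢ r<a ∷ ℕ.<⇒≢ a<c ∷ []) ∷ (ℕ.<⇒≢ r<c ∷ []) ∷ [] ∷ []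
  , (ℕ.<⇒≢ m<v ∷ ℕ.<⇒≢ m<w ∷ []) ∷ (ℕ.<⇒≢ v<w ∷ []) ∷ [] ∷ []
  , (ℕ.>⇒≢ m<a ∷ ℕ.<⇒≢ a<v ∷ ℕ.<⇒≢ a<w ∷ [])
  ∷ (ℕ.>⇒≢ m<r ∷ ℕ.<⇒≢ r<v ∷ ℕ.<⇒≢ r<w ∷ [])
  ∷ (ℕ.>⇒≢ m<c ∷ ℕ.<⇒≢ c<v ∷ ℕ.<⇒≢ c<w ∷ [])
  ∷ []

triple-positive : ∀ {x y} → 0 < x → 0 < y → All (λ z → 0 < ∣ z ∣) (triple (+ x) (+ y))
triple-positive {x} {y} 0<x 0<y =
  0<x ∷ 0<y ∷ subst (0 <_) (sym (abs-neg (x ℕ.+ y))) (ℕ.<-≤-trans 0<x (ℕ.m≤m+n x y)) ∷ []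

-- With q = m + 1 and r = n q (q + 1) the absolute values of the entries are
-- m < r < m + rq < m + r(q+1) < q (m + r(q+1)) < (q + 1)(m + rq).
narrow : ∀ m n .{{_ : NonZero m}} .{{_ : NonZero n}} → IntegerSolution m n 3 3
narrow m n = record
  { xs = triple (+ a) (+ r) ; ys = triple (+ m) (+ v)
  ; length-xs = refl ; length-ys = refl
  ; equation₁ = vanishing-sums m n {triple (+ a) (+ r)} {triple (+ m) (+ v)}
                  (sum-triple (+ a) (+ r)) (sum-triple (+ m) (+ v))
  ; equation₃ = equation
  ; positive-xs = triple-positive (ℕ.<-≤-trans 0<m (ℕ.m≤m+n m (r ℕ.* q))) (ℕ.>-nonZero⁻¹ r)
  ; positive-ys = triple-positive 0<m (ℕ.>-nonZero⁻¹ v)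
  ; distinct-xs = proj₁ separated
  ; distinct-ys = proj₁ (proj₂ separated)
  ; distinct = proj₂ (proj₂ separated)
  }
  where
  q p r a c v w : ℕ
  q = suc m
  p = suc q
  r = n ℕ.* p ℕ.* q
  a = m ℕ.+ r ℕ.* q
  c = a ℕ.+ r
  v = q ℕ.* c
  w = m ℕ.+ v

  0<m : 0 < m
  0<m = ℕ.>-nonZero⁻¹ m

  instance
    r≢0 : NonZero r
    r≢0 = ℕ.m*n≢0 (n ℕ.* p) q {{ℕ.m*n≢0 n p}}
    c≢0 : NonZero c
    c≢0 = ℕ.>-nonZero (ℕ.<-≤-trans (ℕ.>-nonZero⁻¹ r) (ℕ.m≤n+m r a))
    v≢0 : NonZero v
    v≢0 = ℕ.m*n≢0 q c

  sorted : AllPairs _<_ (m ∷ r ∷ a ∷ c ∷ v ∷ w ∷ [])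
  sorted = Linked⇒AllPairs ℕ.<-trans
    -- `m < r` unfolds to `q ≤ r`, as `q` is `suc m`.
    ( ℕ.m≤n*m q (n ℕ.* p) {{ℕ.m*n≢0 n p}}
    ∷ ℕ.≤-<-trans (ℕ.m≤m*n r q) (ℕ.m<n+m (r ℕ.* q) 0<m)
    ∷ ℕ.m<m+n a (ℕ.>-nonZero⁻¹ r)
    ∷ subst (c <_) (ℕ.*-comm c q) (ℕ.m<m*n c q (s≤s 0<m))
    ∷ ℕ.m<n+m v 0<m
    ∷ [-])

  separated : AllPairs _#_ (triple (+ a) (+ r)) ×
              AllPairs _#_ (triple (+ m) (+ v)) ×
              All (λ x → All (x #_) (triple (+ m) (+ v))) (triple (+ a) (+ r))
  separated = interleaved-distinct (AllPairs.map⁻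
    (subst₂ (λ c w → AllPairs _<_ (m ∷ r ∷ a ∷ c ∷ v ∷ w ∷ []))
            (sym (abs-neg c)) (sym (abs-neg w)) sorted))

  -- This factorization holds for every value of `r`, which leaves `r` free to absorb the factor n p
  -- q.
  w≡pa : w ≡ p ℕ.* a
  w≡pa = identity m q r
    where
    identity : ∀ m q r → m ℕ.+ q ℕ.* (m ℕ.+ r ℕ.* q ℕ.+ r) ≡ suc q ℕ.* (m ℕ.+ r ℕ.* q)
    identity = ℕ-Solver.solve-∀

  -- With r = n p q, v = q c and w = p a both sides are m n p q a c.
  products : m ℕ.* (a ℕ.* r ℕ.* c) ≡ n ℕ.* (m ℕ.* v ℕ.* w)
  products = trans (identity m n p q a c) (cong (λ k → n ℕ.* (m ℕ.* v ℕ.* k)) (sym w≡pa))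
    where
    identity : ∀ m n p q a c → m ℕ.* (a ℕ.* (n ℕ.* p ℕ.* q) ℕ.* c)
                             ≡ n ℕ.* (m ℕ.* (q ℕ.* c) ℕ.* (p ℕ.* a))
    identity = ℕ-Solver.solve-∀

  scaled-cubes : ∀ k x y → + k ℤ.* powerSum 3 (triple (+ x) (+ y))
                         ≡ ℤ.- (+ 3) ℤ.* + (k ℕ.* (x ℕ.* y ℕ.* (x ℕ.+ y)))
  scaled-cubes k x y = begin
    + k ℤ.* powerSum 3 (triple (+ x) (+ y))                   ≡⟨ cong (+ k ℤ.*_) (cubes-triple (+ x) (+ y)) ⟩
    + k ℤ.* (ℤ.- (+ 3) ℤ.* (+ x ℤ.* + y ℤ.* + (x ℕ.+ y)))     ≡⟨ commute (+ k) _ ⟩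
    ℤ.- (+ 3) ℤ.* (+ k ℤ.* (+ x ℤ.* + y ℤ.* + (x ℕ.+ y)))     ≡⟨ cong (ℤ.- (+ 3) ℤ.*_) push ⟨
    ℤ.- (+ 3) ℤ.* + (k ℕ.* (x ℕ.* y ℕ.* (x ℕ.+ y)))           ∎
    where
    open ≡-Reasoning
    commute : ∀ k s → k ℤ.* (ℤ.- (+ 3) ℤ.* s) ≡ ℤ.- (+ 3) ℤ.* (k ℤ.* s)
    commute = solve-∀
    push : + (k ℕ.* (x ℕ.* y ℕ.* (x ℕ.+ y))) ≡ + k ℤ.* (+ x ℤ.* + y ℤ.* + (x ℕ.+ y))
    push = trans (ℤₚ.pos-* k _) (cong (+ k ℤ.*_) (trans (ℤₚ.pos-* (x ℕ.* y) _)
             (cong (ℤ._* + (x ℕ.+ y)) (ℤₚ.pos-* x y))))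

  equation : + m ℤ.* powerSum 3 (triple (+ a) (+ r)) ≡ + n ℤ.* powerSum 3 (triple (+ m) (+ v))
  equation = begin
    + m ℤ.* powerSum 3 (triple (+ a) (+ r))       ≡⟨ scaled-cubes m a r ⟩
    ℤ.- (+ 3) ℤ.* + (m ℕ.* (a ℕ.* r ℕ.* c))       ≡⟨ cong (λ k → ℤ.- (+ 3) ℤ.* + k) products ⟩
    ℤ.- (+ 3) ℤ.* + (n ℕ.* (m ℕ.* v ℕ.* w))       ≡⟨ scaled-cubes n m v ⟨
    + n ℤ.* powerSum 3 (triple (+ m) (+ v))       ∎
    where open ≡-Reasoning

-- Zero-sum padding

-- The value is 3 · 2^j, and `balanced j` lists 3 · 2^j, -3 · 2^(j-1), ..., -6, -3, -2, -1. Passing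
-- from j to j + 1 replaces the leading entry s by 2s and -s, which preserves the sum.
summit : ℕ → ℕ
summit zero    = 3
summit (suc j) = summit j ℕ.+ summit j

descent : ℕ → List ℤ
descent zero    = ℤ.- (+ 2) ∷ ℤ.- (+ 1) ∷ []
descent (suc j) = ℤ.- (+ summit j) ∷ descent j

balanced : ℕ → List ℤ
balanced j = + summit j ∷ descent j

summit>0 : ∀ j → 0 < summit j
summit>0 zero    = s≤s z≤n
summit>0 (suc j) = ℕ.<-≤-trans (summit>0 j) (ℕ.m≤m+n _ _)

length-balanced : ∀ j → length (balanced j) ≡ 3 ℕ.+ j
length-balanced zero    = refl
length-balanced (suc j) = cong suc (length-balanced j)

sum-balanced : ∀ j → powerSum 1 (balanced j) ≡ 0ℤ
sum-balanced zero    = refl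
sum-balanced (suc j) = trans (step (+ summit j) (powerSum 1 (descent j))) (sum-balanced j)
  where
  step : ∀ s p → (s ℤ.+ s) ℤ.* 1ℤ ℤ.+ (ℤ.- s ℤ.* 1ℤ ℤ.+ p) ≡ s ℤ.* 1ℤ ℤ.+ p
  step = solve-∀

-- The sum starts at 27 - 8 - 1 = 18, and each step adds (2s)³ - s³ - s³ = 6s³, so it stays
-- positive.
cubes-balanced : ∀ j → ∃[ k ] powerSum 3 (balanced j) ≡ + suc k
cubes-balanced zero    = 17 , refl
cubes-balanced (suc j) with k , eq ← cubes-balanced j = k ℕ.+ 6 ℕ.* (s ℕ.* s ℕ.* s) , (begin
  powerSum 3 (balanced (suc j))                          ≡⟨ step (+ s) (powerSum 3 (descent j)) ⟩
  powerSum 3 (balanced j) ℤ.+ + 6 ℤ.* (+ s ℤ.* + s ℤ.* + s) ≡⟨ cong₂ ℤ._+_ eq (sym push) ⟩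
  + (suc k ℕ.+ 6 ℕ.* (s ℕ.* s ℕ.* s))                    ∎)
  where
  open ≡-Reasoning
  s = summit j
  step : ∀ s p → (s ℤ.+ s) ℤ.* ((s ℤ.+ s) ℤ.* ((s ℤ.+ s) ℤ.* 1ℤ)) ℤ.+
                   (ℤ.- s ℤ.* (ℤ.- s ℤ.* (ℤ.- s ℤ.* 1ℤ)) ℤ.+ p)
               ≡ s ℤ.* (s ℤ.* (s ℤ.* 1ℤ)) ℤ.+ p ℤ.+ + 6 ℤ.* (s ℤ.* s ℤ.* s)
  step = solve-∀
  push : + (6 ℕ.* (s ℕ.* s ℕ.* s)) ≡ + 6 ℤ.* (+ s ℤ.* + s ℤ.* + s)
  push = trans (ℤₚ.pos-* 6 (s ℕ.* s ℕ.* s)) (cong (+ 6 ℤ.*_) (trans (ℤₚ.pos-* (s ℕ.* s) s)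
           (cong (ℤ._* + s) (ℤₚ.pos-* s s))))

descent-bounds : ∀ j → All (λ x → 0 < ∣ x ∣ × ∣ x ∣ < summit j) (descent j)
descent-bounds zero    = (s≤s z≤n , s≤s (s≤s (s≤s z≤n))) ∷ (s≤s z≤n , s≤s (s≤s z≤n)) ∷ []
descent-bounds (suc j) =
  subst (λ k → 0 < k × k < s ℕ.+ s) (sym (abs-neg s)) (summit>0 j , s<s+s) ∷
  All.map (λ (0<x , x<s) → 0<x , ℕ.<-trans x<s s<s+s) (descent-bounds j)
  where
  s = summit j
  s<s+s : s < s ℕ.+ s
  s<s+s = ℕ.m<m+n s (summit>0 j)

positive-balanced : ∀ j → All (λ x → 0 < ∣ x ∣) (balanced j)
positive-balanced j = summit>0 j ∷ All.map proj₁ (descent-bounds j)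

bounded-balanced : ∀ j → All (λ x → ∣ x ∣ ≤ summit j) (balanced j)
bounded-balanced j = ℕ.≤-refl ∷ All.map (ℕ.<⇒≤ ∘ proj₂) (descent-bounds j)

distinct-balanced : ∀ j → AllPairs _#_ (balanced j)
distinct-balanced j = All.map (ℕ.>⇒≢ ∘ proj₂) (descent-bounds j) ∷ distinct-descent j
  where
  distinct-descent : ∀ j → AllPairs _#_ (descent j)
  distinct-descent zero    = ((λ ()) ∷ []) ∷ [] ∷ []
  distinct-descent (suc j) =
    All.map (λ (_ , x<s) e → ℕ.>⇒≢ x<s (trans (sym (abs-neg (summit j))) e)) (descent-bounds j)
    ∷ distinct-descent j

abs-scale : ∀ k x → ∣ + k ℤ.* x ∣ ≡ k ℕ.* ∣ x ∣
abs-scale k x = ℤₚ.abs-* (+ k) x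

scale-positive : ∀ c .{{_ : ℤ.NonZero c}} {xs} →
                 All (λ x → 0 < ∣ x ∣) xs → All (λ x → 0 < ∣ x ∣) (map (c ℤ.*_) xs)
scale-positive c = All.map⁺ ∘ All.map λ {x} 0<x →
  subst (0 <_) (sym (ℤₚ.abs-* c x)) (ℕ.*-mono-< (ℕ.>-nonZero⁻¹ ∣ c ∣) 0<x)

scale-# : ∀ c .{{_ : ℤ.NonZero c}} {x y} → x # y → c ℤ.* x # c ℤ.* y
scale-# c {x} {y} x#y e = x#y (ℕ.*-cancelˡ-≡ _ _ ∣ c ∣
  (trans (sym (ℤₚ.abs-* c x)) (trans e (ℤₚ.abs-* c y))))

scale-distinct : ∀ c .{{_ : ℤ.NonZero c}} {xs} → AllPairs _#_ xs → AllPairs _#_ (map (c ℤ.*_) xs)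
scale-distinct c = AllPairs.map⁺ ∘ AllPairs.map (scale-# c)

-- The cubes of `zs` sum to at most 0 and those of `ys` to more than 0. Hence n times the latter
-- minus m times the former is a positive natural number, the `imbalance` that a block has to make
-- up for. The block entries are to exceed the scaled `bound`.
record Padding (e f : ℕ) : Set where
  field
    zs ys          : List ℤ
    length-zs      : length zs ≡ e
    length-ys      : length ys ≡ f
    sum-zs         : powerSum 1 zs ≡ 0ℤ
    sum-ys         : powerSum 1 ys ≡ 0ℤ
    deficit excess : ℕ
    cubes-zs       : powerSum 3 zs ≡ ℤ.- (+ deficit)
    cubes-ys       : powerSum 3 ys ≡ + suc excess
    positive-zs    : All (λ x → 0 < ∣ x ∣) zs
    positive-ys    : All (λ x → 0 < ∣ x ∣) ys
    distinct-zs    : AllPairs _#_ zs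
    distinct-ys    : AllPairs _#_ ys
    distinct       : All (λ z → All (z #_) ys) zs
    bound          : ℕ
    bounded-zs     : All (λ x → ∣ x ∣ ≤ bound) zs
    bounded-ys     : All (λ x → ∣ x ∣ ≤ bound) ys

-- For the cases in which a block alone forms the left-hand side.
rightPadding : ∀ j → Padding 0 (3 ℕ.+ j)
rightPadding j = record
  { zs = [] ; ys = balanced j ; length-zs = refl ; length-ys = length-balanced j
  ; sum-zs = refl ; sum-ys = sum-balanced j
  ; deficit = 0 ; excess = proj₁ (cubes-balanced j)
  ; cubes-zs = refl ; cubes-ys = proj₂ (cubes-balanced j)
  ; positive-zs = [] ; positive-ys = positive-balanced j
  ; distinct-zs = [] ; distinct-ys = distinct-balanced j ; distinct = []
  ; bound = summit j ; bounded-zs = [] ; bounded-ys = bounded-balanced j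
  }

cube-pos : ∀ k → cube (+ k) ≡ + (k ℕ.* k ℕ.* k)
cube-pos k = sym (trans (ℤₚ.pos-* (k ℕ.* k) k) (cong (ℤ._* + k) (ℤₚ.pos-* k k)))

-- The factor -(summit j + 1) moves the left padding above the right padding
-- and makes the sums of cubes of the two have opposite signs.
padding : ∀ i j → Padding (3 ℕ.+ i) (3 ℕ.+ j)
padding i j = record
  { zs = map (ℤ.- (+ c) ℤ.*_) (balanced i) ; ys = balanced j
  ; length-zs = trans (length-map _ (balanced i)) (length-balanced i)
  ; length-ys = length-balanced j
  ; sum-zs = trans (powerSum-scale₁ (ℤ.- (+ c)) (balanced i))
               (trans (cong (ℤ.- (+ c) ℤ.*_) (sum-balanced i)) (ℤₚ.*-zeroʳ (ℤ.- (+ c))))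
  ; sum-ys = sum-balanced j
  ; deficit = c ℕ.* c ℕ.* c ℕ.* suc k ; excess = proj₁ (cubes-balanced j)
  ; cubes-zs = cubes ; cubes-ys = proj₂ (cubes-balanced j)
  ; positive-zs = scale-positive (ℤ.- (+ c)) (positive-balanced i)
  ; positive-ys = positive-balanced j
  ; distinct-zs = scale-distinct (ℤ.- (+ c)) (distinct-balanced i)
  ; distinct-ys = distinct-balanced j
  ; distinct = All.map⁺ (All.map (λ {x} 0<x → All.map (λ {y} → above {x} {y} 0<x) (bounded-balanced j))
                                 (positive-balanced i))
  ; bound = c ℕ.* summit i
  ; bounded-zs = All.map⁺ (All.map (λ {x} x≤s → subst (_≤ c ℕ.* summit i) (sym (abs x)) (ℕ.*-monoʳ-≤ c x≤s))
                                   (bounded-balanced i))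
  ; bounded-ys = All.map (λ y≤s → ℕ.≤-trans y≤s (ℕ.≤-trans (ℕ.n≤1+n _) (ℕ.m≤m*n c (summit i) {{ℕ.>-nonZero (summit>0 i)}})))
                         (bounded-balanced j)
  }
  where
  c = suc (summit j)
  k = proj₁ (cubes-balanced i)

  abs : ∀ x → ∣ ℤ.- (+ c) ℤ.* x ∣ ≡ c ℕ.* ∣ x ∣
  abs x = ℤₚ.abs-* (ℤ.- (+ c)) x

  above : ∀ {x y} → 0 < ∣ x ∣ → ∣ y ∣ ≤ summit j → ℤ.- (+ c) ℤ.* x # y
  above {x} 0<x y≤s = ℕ.>⇒≢ (ℕ.<-≤-trans (s≤s y≤s)
    (subst (c ≤_) (sym (abs x)) (ℕ.m≤m*n c ∣ x ∣ {{ℕ.>-nonZero 0<x}})))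

  cubes : powerSum 3 (map (ℤ.- (+ c) ℤ.*_) (balanced i)) ≡ ℤ.- (+ (c ℕ.* c ℕ.* c ℕ.* suc k))
  cubes = begin
    powerSum 3 (map (ℤ.- (+ c) ℤ.*_) (balanced i)) ≡⟨ powerSum-scale₃ (ℤ.- (+ c)) (balanced i) ⟩
    cube (ℤ.- (+ c)) ℤ.* powerSum 3 (balanced i)   ≡⟨ cong (cube (ℤ.- (+ c)) ℤ.*_) (proj₂ (cubes-balanced i)) ⟩
    cube (ℤ.- (+ c)) ℤ.* + suc k                   ≡⟨ sign (+ c) (+ suc k) ⟩
    ℤ.- (cube (+ c) ℤ.* + suc k)                   ≡⟨ cong (λ d → ℤ.- (d ℤ.* + suc k)) (cube-pos c) ⟩
    ℤ.- (+ (c ℕ.* c ℕ.* c) ℤ.* + suc k)            ≡⟨ cong ℤ.-_ (ℤₚ.pos-* (c ℕ.* c ℕ.* c) (suc k)) ⟨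
    ℤ.- (+ (c ℕ.* c ℕ.* c ℕ.* suc k))              ∎
    where
    open ≡-Reasoning
    sign : ∀ c s → ℤ.- c ℤ.* ℤ.- c ℤ.* ℤ.- c ℤ.* s ≡ ℤ.- (c ℤ.* c ℤ.* c ℤ.* s)
    sign = solve-∀

-- At least four terms on the left

-- Slope and offset share one sign, so the absolute value at a natural number t is a t + b and
-- comparisons take place in ℕ.
Affine : Set
Affine = Sign × ℕ × ℕ

at : ℕ → Affine → ℤ
at t (s , a , b) = s ◃ (a ℕ.* t ℕ.+ b)

slope offset : Affine → ℤ
slope  (s , a , b) = s ◃ a
offset (s , a , b) = s ◃ b

-- Ensures a t + b < a′ t + b′ for every natural t. Strictness is asked of the offsets because
-- slopes coincide in `block₄` and `block₆`.
_≺_ : Affine → Affine → Set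
(_ , a , b) ≺ (_ , a′ , b′) = a ≤ a′ × b < b′

at-affine : ∀ t p → at t p ≡ slope p ℤ.* + t ℤ.+ offset p
at-affine t (s , a , b) = trans (ℤₚ.◃-distrib-+ s (a ℕ.* t) b) (cong (ℤ._+ (s ◃ b)) (begin
  s ◃ (a ℕ.* t)             ≡⟨ cong (_◃ (a ℕ.* t)) (Sign.*-identityʳ s) ⟨
  (s Sign.* Sign.+) ◃ (a ℕ.* t) ≡⟨ ℤₚ.◃-distrib-* s Sign.+ a t ⟩
  (s ◃ a) ℤ.* (Sign.+ ◃ t)  ≡⟨ cong ((s ◃ a) ℤ.*_) (ℤₚ.+◃n≡+n t) ⟩
  (s ◃ a) ℤ.* + t           ∎))
  where open ≡-Reasoning

sum-at : ∀ t ps → powerSum 1 (map (at t) ps) ≡ + t ℤ.* sumOf slope ps ℤ.+ sumOf offset ps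
sum-at t []       = sym (trans (ℤₚ.+-identityʳ _) (ℤₚ.*-zeroʳ (+ t)))
sum-at t (p ∷ ps) = begin
  at t p ℤ.* 1ℤ ℤ.+ powerSum 1 (map (at t) ps)
    ≡⟨ cong₂ (λ x s → x ℤ.* 1ℤ ℤ.+ s) (at-affine t p) (sum-at t ps) ⟩
  (slope p ℤ.* + t ℤ.+ offset p) ℤ.* 1ℤ ℤ.+ (+ t ℤ.* sumOf slope ps ℤ.+ sumOf offset ps)
    ≡⟨ step (+ t) (slope p) (offset p) (sumOf slope ps) (sumOf offset ps) ⟩
  + t ℤ.* (slope p ℤ.+ sumOf slope ps) ℤ.+ (offset p ℤ.+ sumOf offset ps) ∎
  where
  open ≡-Reasoning
  step : ∀ t a b A B → (a ℤ.* t ℤ.+ b) ℤ.* 1ℤ ℤ.+ (t ℤ.* A ℤ.+ B) ≡ t ℤ.* (a ℤ.+ A) ℤ.+ (b ℤ.+ B)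
  step = solve-∀

slope²·offset slope·offset² : Affine → ℤ
slope²·offset p = slope p ℤ.* slope p ℤ.* offset p
slope·offset² p = slope p ℤ.* offset p ℤ.* offset p

-- Binomial expansion collected by powers of t. The factor 3 stays within the coefficient of t,
-- which `Block` sets equal to `G`.
cubes-at : ∀ t ps → powerSum 3 (map (at t) ps) ≡
  cube (+ t) ℤ.* sumOf (cube ∘ slope) ps ℤ.+ + 3 ℤ.* + t ℤ.* + t ℤ.* sumOf slope²·offset ps ℤ.+
  + t ℤ.* (+ 3 ℤ.* sumOf slope·offset² ps) ℤ.+ sumOf (cube ∘ offset) ps
cubes-at t []       = zeros (+ t)
  where
  zeros : ∀ t → 0ℤ ≡ t ℤ.* t ℤ.* t ℤ.* 0ℤ ℤ.+ + 3 ℤ.* t ℤ.* t ℤ.* 0ℤ ℤ.+ t ℤ.* (+ 3 ℤ.* 0ℤ) ℤ.+ 0ℤ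
  zeros = solve-∀
cubes-at t (p ∷ ps) = trans
  (cong₂ (λ x s → x ℤ.^ 3 ℤ.+ s) (at-affine t p) (cubes-at t ps))
  (step (+ t) (slope p) (offset p) (sumOf (cube ∘ slope) ps) (sumOf slope²·offset ps)
        (sumOf slope·offset² ps) (sumOf (cube ∘ offset) ps))
  where
  step : ∀ t a b A B C E →
    (a ℤ.* t ℤ.+ b) ℤ.* ((a ℤ.* t ℤ.+ b) ℤ.* ((a ℤ.* t ℤ.+ b) ℤ.* 1ℤ)) ℤ.+
      (t ℤ.* t ℤ.* t ℤ.* A ℤ.+ + 3 ℤ.* t ℤ.* t ℤ.* B ℤ.+ t ℤ.* (+ 3 ℤ.* C) ℤ.+ E)
    ≡ t ℤ.* t ℤ.* t ℤ.* (a ℤ.* a ℤ.* a ℤ.+ A) ℤ.+ + 3 ℤ.* t ℤ.* t ℤ.* (a ℤ.* a ℤ.* b ℤ.+ B) ℤ.+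
      t ℤ.* (+ 3 ℤ.* (a ℤ.* b ℤ.* b ℤ.+ C)) ℤ.+ (b ℤ.* b ℤ.* b ℤ.+ E)
  step = solve-∀

-- The terms in t³ and t² vanish from the sum of cubes. The constant term is a multiple of the
-- coefficient `G` of t, so the sum is G (t + c) and can be solved for t whenever the target is a
-- large enough multiple of `G`.
record Block (ℓ : ℕ) : Set where
  field
    terms         : List Affine
    length-terms  : length terms ≡ ℓ
    G c           : ℕ
    {{G-nonZero}} : NonZero G
    Σslope        : sumOf slope terms ≡ 0ℤ
    Σoffset       : sumOf offset terms ≡ 0ℤ
    Σslope³       : sumOf (cube ∘ slope) terms ≡ 0ℤ
    Σslope²offset : sumOf slope²·offset terms ≡ 0ℤ
    Σslopeoffset² : + 3 ℤ.* sumOf slope·offset² terms ≡ + G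
    Σoffset³      : sumOf (cube ∘ offset) terms ≡ + (G ℕ.* c)
    increasing    : All (λ (_ , a , _) → 1 ≤ a) terms
    sorted        : AllPairs _≺_ terms

  at-terms : ℕ → List ℤ
  at-terms t = map (at t) terms

  sum-terms : ∀ t → powerSum 1 (at-terms t) ≡ 0ℤ
  sum-terms t = trans (sum-at t terms)
    (trans (cong₂ (λ A B → + t ℤ.* A ℤ.+ B) Σslope Σoffset) (trans (ℤₚ.+-identityʳ _) (ℤₚ.*-zeroʳ (+ t))))

  cubes-terms : ∀ t → powerSum 3 (at-terms t) ≡ + (G ℕ.* (t ℕ.+ c))
  cubes-terms t = begin
    powerSum 3 (at-terms t)
      ≡⟨ cubes-at t terms ⟩
    cube (+ t) ℤ.* S₃ ℤ.+ + 3 ℤ.* + t ℤ.* + t ℤ.* S₂ ℤ.+ + t ℤ.* S₁ ℤ.+ S₀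
      ≡⟨ cong₂ (λ S₃ S₂ → cube (+ t) ℤ.* S₃ ℤ.+ + 3 ℤ.* + t ℤ.* + t ℤ.* S₂ ℤ.+ + t ℤ.* S₁ ℤ.+ S₀) Σslope³ Σslope²offset ⟩
    cube (+ t) ℤ.* 0ℤ ℤ.+ + 3 ℤ.* + t ℤ.* + t ℤ.* 0ℤ ℤ.+ + t ℤ.* S₁ ℤ.+ S₀
      ≡⟨ drop (+ t) S₁ S₀ ⟩
    S₁ ℤ.* + t ℤ.+ S₀
      ≡⟨ cong₂ (λ S₁ S₀ → S₁ ℤ.* + t ℤ.+ S₀) Σslopeoffset² Σoffset³ ⟩
    + G ℤ.* + t ℤ.+ + (G ℕ.* c)
      ≡⟨ cong (ℤ._+ + (G ℕ.* c)) (ℤₚ.pos-* G t) ⟨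
    + (G ℕ.* t ℕ.+ G ℕ.* c)
      ≡⟨ cong (λ k → + k) (ℕ.*-distribˡ-+ G t c) ⟨
    + (G ℕ.* (t ℕ.+ c)) ∎
    where
    open ≡-Reasoning
    S₃ = sumOf (cube ∘ slope) terms
    S₂ = sumOf slope²·offset terms
    S₁ = + 3 ℤ.* sumOf slope·offset² terms
    S₀ = sumOf (cube ∘ offset) terms
    drop : ∀ t C E → t ℤ.* t ℤ.* t ℤ.* 0ℤ ℤ.+ + 3 ℤ.* t ℤ.* t ℤ.* 0ℤ ℤ.+ t ℤ.* C ℤ.+ E ≡ C ℤ.* t ℤ.+ E
    drop = solve-∀

  large-terms : ∀ t → All (λ x → t ≤ ∣ x ∣) (at-terms t)
  large-terms t = All.map⁺ (All.map large increasing)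
    where
    large : ∀ {p : Affine} → 1 ≤ proj₁ (proj₂ p) → t ≤ ∣ at t p ∣
    large {s , a , b} 1≤a = subst (t ≤_) (sym (ℤₚ.abs-◃ s _))
      (ℕ.≤-trans (ℕ.m≤n*m t a {{ℕ.>-nonZero 1≤a}}) (ℕ.m≤m+n (a ℕ.* t) b))

  distinct-terms : ∀ t → AllPairs _#_ (at-terms t)
  distinct-terms t = AllPairs.map⁺ (AllPairs.map (λ {p} {q} → separate {p} {q}) sorted)
    where
    separate : ∀ {p q} → p ≺ q → at t p # at t q
    separate {s , a , b} {s′ , a′ , b′} (a≤a′ , b<b′) e =
      ℕ.<⇒≢ (ℕ.+-mono-≤-< (ℕ.*-monoˡ-≤ t a≤a′) b<b′)
        (trans (sym (ℤₚ.abs-◃ s _)) (trans e (ℤₚ.abs-◃ s′ _)))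

-- Deciding the conditions lets the concrete blocks be checked by evaluation through `toWitness`.
sorted? : ∀ ps → Dec (AllPairs _≺_ ps)
sorted? = AllPairs.allPairs? λ (_ , a , b) (_ , a′ , b′) → (a ℕ.≤? a′) ×-dec (b ℕ.<? b′)

increasing? : (ps : List Affine) → Dec (All (λ (_ , a , _) → 1 ≤ a) ps)
increasing? = All.all? λ (_ , a , _) → 1 ℕ.≤? a

-- With T = t + 3: T + 2, T - 2, -(T + 1), -(T - 1), with sum of cubes 18 T.
block₄ : Block 4
block₄ = record
  { terms = (Sign.+ , 1 , 1) ∷ (Sign.- , 1 , 2) ∷ (Sign.- , 1 , 4) ∷ (Sign.+ , 1 , 5) ∷ []
  ; G = 18 ; c = 3 ; length-terms = refl
  ; Σslope = refl ; Σoffset = refl ; Σslope³ = refl ; Σslope²offset = refl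
  ; Σslopeoffset² = refl ; Σoffset³ = refl
  ; increasing = toWitness {a? = increasing? _} _ ; sorted = toWitness {a? = sorted? _} _
  }

-- With T = t + 4: -T + 3, -5T - 2, 7T - 4, 8T, -9T + 3, found by search, with
-- sum of cubes 6 (T - 3).
block₅ : Block 5
block₅ = record
  { terms = (Sign.- , 1 , 1) ∷ (Sign.- , 5 , 22) ∷ (Sign.+ , 7 , 24) ∷ (Sign.+ , 8 , 32) ∷
            (Sign.- , 9 , 33) ∷ []
  ; G = 6 ; c = 1 ; length-terms = refl
  ; Σslope = refl ; Σoffset = refl ; Σslope³ = refl ; Σslope²offset = refl
  ; Σslopeoffset² = refl ; Σoffset³ = refl
  ; increasing = toWitness {a? = increasing? _} _ ; sorted = toWitness {a? = sorted? _} _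
  }

-- With T = t + 1: T + {0, 7, 8} and -(T + {1, 5, 9}), with sum of cubes 18 T.
block₆ : Block 6
block₆ = record
  { terms = (Sign.+ , 1 , 1) ∷ (Sign.- , 1 , 2) ∷ (Sign.- , 1 , 6) ∷ (Sign.+ , 1 , 8) ∷
            (Sign.+ , 1 , 9) ∷ (Sign.- , 1 , 10) ∷ []
  ; G = 18 ; c = 1 ; length-terms = refl
  ; Σslope = refl ; Σoffset = refl ; Σslope³ = refl ; Σslope²offset = refl
  ; Σslopeoffset² = refl ; Σoffset³ = refl
  ; increasing = toWitness {a? = increasing? _} _ ; sorted = toWitness {a? = sorted? _} _
  }

-- Writing H = G m, K for the imbalance of the padding and μ = H κ for its
-- scaling factor, the equation for the cubes becomes t + c = H² κ³ K.
parameter : ∀ H K M c .{{_ : NonZero H}} .{{_ : NonZero K}} →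
            ∃[ κ ] ∃[ t ] NonZero κ × H ℕ.* κ ℕ.* M < t ×
            t ℕ.+ c ≡ H ℕ.* κ ℕ.* κ ℕ.* (H ℕ.* κ ℕ.* K)
parameter H K M c = κ , H ℕ.* κ ℕ.* M ℕ.+ suc d , κ≢0 , ℕ.m<m+n _ (s≤s z≤n) , (begin
  H ℕ.* κ ℕ.* M ℕ.+ suc d ℕ.+ c     ≡⟨ rearrange (H ℕ.* κ ℕ.* M) d c ⟩
  H ℕ.* κ ℕ.* M ℕ.+ suc c ℕ.+ d     ≡⟨ ℕ.m+[n∸m]≡n low ⟩
  H ℕ.* κ ℕ.* κ ℕ.* (H ℕ.* κ ℕ.* K) ∎)
  where
  open ≡-Reasoning
  -- Chosen so that H κ M + (c + 1) ≤ H κ (M + c + 1) = H κ κ, which gives `low`; the slack `d` then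
  -- goes into t.
  κ = M ℕ.+ suc c
  instance
    κ≢0 : NonZero κ
    κ≢0 = ℕ.>-nonZero (ℕ.<-≤-trans (s≤s z≤n) (ℕ.m≤n+m (suc c) M))
    Hκ≢0 : NonZero (H ℕ.* κ)
    Hκ≢0 = ℕ.m*n≢0 H κ
    HκK≢0 : NonZero (H ℕ.* κ ℕ.* K)
    HκK≢0 = ℕ.m*n≢0 (H ℕ.* κ) K
  low : H ℕ.* κ ℕ.* M ℕ.+ suc c ≤ H ℕ.* κ ℕ.* κ ℕ.* (H ℕ.* κ ℕ.* K)
  low = ℕ.≤-trans (ℕ.+-monoʳ-≤ (H ℕ.* κ ℕ.* M) (ℕ.m≤n*m (suc c) (H ℕ.* κ)))
    (ℕ.≤-trans (ℕ.≤-reflexive (sym (ℕ.*-distribˡ-+ (H ℕ.* κ) M (suc c))))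
      (ℕ.m≤m*n (H ℕ.* κ ℕ.* κ) (H ℕ.* κ ℕ.* K)))
  d = H ℕ.* κ ℕ.* κ ℕ.* (H ℕ.* κ ℕ.* K) ℕ.∸ (H ℕ.* κ ℕ.* M ℕ.+ suc c)
  rearrange : ∀ x d c → x ℕ.+ suc d ℕ.+ c ≡ x ℕ.+ suc c ℕ.+ d
  rearrange = ℕ-Solver.solve-∀

-- Joining a block to a padding

imbalance : ∀ {e f} (m n : ℕ) → Padding e f → ℕ
imbalance m n pad = n ℕ.* suc excess ℕ.+ m ℕ.* deficit
  where open Padding pad

-- The lower bound on t puts every block entry above the scaled padding in absolute value, so
-- distinctness is only needed within the block and within the padding. The equation for t + c
-- balances the cubes.
combine : ∀ {ℓ e f} m n .{{_ : NonZero m}} (block : Block ℓ) (pad : Padding e f) →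
          let open Block block; H = G ℕ.* m in
          ∀ κ t .{{_ : NonZero κ}} → H ℕ.* κ ℕ.* Padding.bound pad < t →
          t ℕ.+ c ≡ H ℕ.* κ ℕ.* κ ℕ.* (H ℕ.* κ ℕ.* imbalance m n pad) →
          IntegerSolution m n (ℓ ℕ.+ e) f
combine m n block pad κ t large t+c = record
  { xs = at-terms t ++ map scale zs
  ; ys = map scale ys
  ; length-xs = trans (length-++ (at-terms t))
      (cong₂ ℕ._+_ (trans (length-map (at t) terms) length-terms) (trans (length-map scale zs) length-zs))
  ; length-ys = trans (length-map scale ys) length-ys
  ; equation₁ = vanishing-sums m n {at-terms t ++ map scale zs} {map scale ys}
      (trans (sumOf-++ (ℤ._^ 1) (at-terms t) (map scale zs))
             (cong₂ ℤ._+_ (sum-terms t) (sum-scale {zs} sum-zs)))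
      (sum-scale {ys} sum-ys)
  ; equation₃ = equation
  ; positive-xs = All.++⁺ (All.map (ℕ.<-≤-trans (ℕ.≤-<-trans z≤n large)) (large-terms t))
                          (scale-positive (+ μ) positive-zs)
  ; positive-ys = scale-positive (+ μ) positive-ys
  ; distinct-xs = AllPairs.++⁺ (distinct-terms t) (scale-distinct (+ μ) distinct-zs) (above bounded-zs)
  ; distinct-ys = scale-distinct (+ μ) distinct-ys
  ; distinct = All.++⁺ (above bounded-ys)
      (All.map⁺ (All.map (λ {x} z#ys → All.map⁺ (All.map (λ {y} → scale-# (+ μ) {x} {y}) z#ys)) distinct))
  }
  where
  open Block block
  open Padding pad

  H μ : ℕ
  H = G ℕ.* m
  μ = H ℕ.* κ

  instance
    μ≢0 : NonZero μ
    μ≢0 = ℕ.m*n≢0 H κ {{ℕ.m*n≢0 G m}}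

  scale : ℤ → ℤ
  scale = + μ ℤ.*_

  sum-scale : ∀ {ws} → powerSum 1 ws ≡ 0ℤ → powerSum 1 (map scale ws) ≡ 0ℤ
  sum-scale {ws} p = trans (powerSum-scale₁ (+ μ) ws) (trans (cong scale p) (ℤₚ.*-zeroʳ (+ μ)))

  above : ∀ {ws} → All (λ w → ∣ w ∣ ≤ bound) ws →
          All (λ x → All (x #_) (map scale ws)) (at-terms t)
  above bounded = All.map (λ t≤x → All.map⁺ (All.map (λ {w} w≤b → ℕ.>⇒≢ (ℕ.<-≤-trans
    (ℕ.≤-<-trans (ℕ.≤-trans (ℕ.≤-reflexive (abs-scale μ w)) (ℕ.*-monoʳ-≤ μ w≤b)) large) t≤x))
    bounded)) (large-terms t)

  cubes-scale : ∀ ws {s} → powerSum 3 ws ≡ s → powerSum 3 (map scale ws) ≡ + (μ ℕ.* μ ℕ.* μ) ℤ.* s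
  cubes-scale ws p = trans (powerSum-scale₃ (+ μ) ws) (cong₂ ℤ._*_ (cube-pos μ) p)

  -- Both sides are μ³ times the imbalance, since m G = H and H · H κ κ · H κ = μ³.
  balance : m ℕ.* (G ℕ.* (t ℕ.+ c)) ≡
            n ℕ.* (μ ℕ.* μ ℕ.* μ ℕ.* suc excess) ℕ.+ m ℕ.* (μ ℕ.* μ ℕ.* μ ℕ.* deficit)
  balance = trans (cong (λ s → m ℕ.* (G ℕ.* s)) t+c) (identity m n G κ (suc excess) deficit)
    where
    identity : ∀ m n G κ a b →
      m ℕ.* (G ℕ.* (G ℕ.* m ℕ.* κ ℕ.* κ ℕ.* (G ℕ.* m ℕ.* κ ℕ.* (n ℕ.* a ℕ.+ m ℕ.* b)))) ≡
      n ℕ.* (G ℕ.* m ℕ.* κ ℕ.* (G ℕ.* m ℕ.* κ) ℕ.* (G ℕ.* m ℕ.* κ) ℕ.* a) ℕ.+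
      m ℕ.* (G ℕ.* m ℕ.* κ ℕ.* (G ℕ.* m ℕ.* κ) ℕ.* (G ℕ.* m ℕ.* κ) ℕ.* b)
    identity = ℕ-Solver.solve-∀

  -- `balance` avoids subtraction by keeping the deficit on the right; here it returns to the left
  -- with its minus sign.
  transfer : ∀ {a p b} → m ℕ.* a ≡ n ℕ.* (p ℕ.* suc excess) ℕ.+ m ℕ.* (p ℕ.* b) →
             + m ℤ.* (+ a ℤ.+ + p ℤ.* ℤ.- (+ b)) ≡ + n ℤ.* (+ p ℤ.* + suc excess)
  transfer {a} {p} {b} eq = begin
    + m ℤ.* (+ a ℤ.+ + p ℤ.* ℤ.- (+ b))                ≡⟨ distrib (+ m) (+ a) (+ p) (+ b) ⟩
    + m ℤ.* + a ℤ.- + m ℤ.* (+ p ℤ.* + b)              ≡⟨ cong₂ ℤ._-_ (ℤₚ.pos-* m a) (pos m b) ⟨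
    + (m ℕ.* a) ℤ.- + (m ℕ.* (p ℕ.* b))                ≡⟨ cong (λ k → + k ℤ.- + (m ℕ.* (p ℕ.* b))) eq ⟩
    + Y ℤ.+ + (m ℕ.* (p ℕ.* b)) ℤ.- + (m ℕ.* (p ℕ.* b)) ≡⟨ cancel (+ Y) (+ (m ℕ.* (p ℕ.* b))) ⟩
    + Y                                                ≡⟨ pos n (suc excess) ⟩
    + n ℤ.* (+ p ℤ.* + suc excess)                     ∎
    where
    open ≡-Reasoning
    Y : ℕ
    Y = n ℕ.* (p ℕ.* suc excess)
    pos : ∀ k s → + (k ℕ.* (p ℕ.* s)) ≡ + k ℤ.* (+ p ℤ.* + s)
    pos k s = trans (ℤₚ.pos-* k (p ℕ.* s)) (cong (+ k ℤ.*_) (ℤₚ.pos-* p s))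
    distrib : ∀ m a p b → m ℤ.* (a ℤ.+ p ℤ.* ℤ.- b) ≡ m ℤ.* a ℤ.+ ℤ.- (m ℤ.* (p ℤ.* b))
    distrib = solve-∀
    cancel : ∀ y z → y ℤ.+ z ℤ.+ ℤ.- z ≡ y
    cancel = solve-∀

  equation : + m ℤ.* powerSum 3 (at-terms t ++ map scale zs) ≡ + n ℤ.* powerSum 3 (map scale ys)
  equation = begin
    + m ℤ.* powerSum 3 (at-terms t ++ map scale zs)
      ≡⟨ cong (+ m ℤ.*_) (sumOf-++ (ℤ._^ 3) (at-terms t) (map scale zs)) ⟩
    + m ℤ.* (powerSum 3 (at-terms t) ℤ.+ powerSum 3 (map scale zs))
      ≡⟨ cong₂ (λ a b → + m ℤ.* (a ℤ.+ b)) (cubes-terms t) (cubes-scale zs cubes-zs) ⟩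
    + m ℤ.* (+ (G ℕ.* (t ℕ.+ c)) ℤ.+ + (μ ℕ.* μ ℕ.* μ) ℤ.* ℤ.- (+ deficit))
      ≡⟨ transfer {G ℕ.* (t ℕ.+ c)} {μ ℕ.* μ ℕ.* μ} {deficit} balance ⟩
    + n ℤ.* (+ (μ ℕ.* μ ℕ.* μ) ℤ.* + suc excess)
      ≡⟨ cong (+ n ℤ.*_) (cubes-scale ys cubes-ys) ⟨
    + n ℤ.* powerSum 3 (map scale ys) ∎
    where open ≡-Reasoning

wide : ∀ {ℓ e f} m n .{{_ : NonZero m}} .{{_ : NonZero n}} →
       Block ℓ → Padding e f → IntegerSolution m n (ℓ ℕ.+ e) f
wide m n block pad =
  let κ , t , κ≢0 , large , t+c = parameter (G ℕ.* m) (imbalance m n pad) bound c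
        {{ℕ.m*n≢0 G m}} {{imbalance≢0}}
  in combine m n block pad κ t {{κ≢0}} large t+c
  where
  open Block block
  open Padding pad
  imbalance≢0 : NonZero (imbalance m n pad)
  imbalance≢0 = ℕ.>-nonZero (ℕ.<-≤-trans (ℕ.>-nonZero⁻¹ (n ℕ.* suc excess) {{ℕ.m*n≢0 n (suc excess)}})
                                         (ℕ.m≤m+n (n ℕ.* suc excess) (m ℕ.* deficit)))

-- A left padding has either no entries or at least three, so `block₄` yields the lengths 4, 7, 8,
-- ...; the other two blocks fill the gaps 5 and 6.
wide-left : ∀ m n .{{_ : NonZero m}} .{{_ : NonZero n}} i j → IntegerSolution m n (4 ℕ.+ i) (3 ℕ.+ j)
wide-left m n 0                   j = wide m n block₄ (rightPadding j)
wide-left m n 1                   j = wide m n block₅ (rightPadding j)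
wide-left m n 2                   j = wide m n block₆ (rightPadding j)
wide-left m n (suc (suc (suc i))) j = wide m n block₄ (padding i j)

-- All numbers of terms, and the theorem

integerSolution : ∀ m n .{{_ : NonZero m}} .{{_ : NonZero n}} i j →
                  IntegerSolution m n (3 ℕ.+ i) (3 ℕ.+ j)
integerSolution m n zero    zero    = narrow m n
-- Only the right-hand side has more than three terms, so the two sides trade places together with m
-- and n.
integerSolution m n zero    (suc j) = swap (wide-left n m j 0)
integerSolution m n (suc i) j       = wide-left m n i j

theorem1 : (t₁ t₂ : ℕ) → 3 ≤ t₁ → 3 ≤ t₂ →
    (m n : ℕ) → 0 < m → 0 < n → Coprime m n →
    InfinitelyMany {m} {n} {t₁} {t₂} (λ s → InNonZeroIntegers s × Nontrivial s)
theorem1 (suc (suc (suc i))) (suc (suc (suc j))) (s≤s (s≤s (s≤s _))) (s≤s (s≤s (s≤s _)))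
         (suc m) (suc n) _ _ _ =
  Lift.infinitelyMany (s≤s z≤n) (integerSolution (suc m) (suc n) i j)
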